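{- It is decidable whether a given two-dimensional domino-complete substitution $\sigma$ is consistent. More precisely, a two-dimensional domino-complete substitution $\sigma$ is consistent if and only if it is consistent on every $2\times 2$ pattern (a pattern whose set of vectors is a translate of $\{0,1\}^2$).
   Context: **Cells and patterns.** Let $\mathcal{A}$ be a finite set of symbols (the alphabet). A $d$-dimensional cell is a pair $c=[v,t]$ with $v\in\mathbb{Z}^d$ (the vector of $c$) and $t\in\mathcal{A}$ (the type of $c$). A $d$-dimensional pattern is a finite set of $d$-dimensional cells with pairwise distinct vectors. Patterns are translated by elements of $\mathbb{Z}^d$ by translating the vectors of their cells. A domino is a two-dimensional pattern consisting of two cells with vectors $v,v'$ such that $v'-v\in\{(\pm1,0),(0,\pm1)\}$. **Substitutions.** A $d$-dimensional substitution $\sigma$ on $\mathcal{A}$ consists of a base rule, i.e. a map $\sigma_{\mathrm{base}}$ from $\mathcal{A}$ to the set of $d$-dimensional patterns, and a finite set of concatenation rules $(t,t',u)\mapsto v$ with $t,t'\in\mathcal{A}$, $u,v\in\mathbb{Z}^d$, $u\neq 0$. All substitutions are assumed deterministic: if a rule has left-hand side $(t,t',u)$, then no other rule has left-hand side $(t,t',u)$ or $(t',t,-u)$. The set of starting patterns of $\sigma$ is $\mathcal{C}_\sigma=\{\{[0,t],[u,t']\} : (t,t',u)\mapsto v \text{ is a rule of } \sigma \text{ for some } v\}$. For cells $c=[u,t]$, $c'=[u',t']$, set $\sigma_{\mathrm{rule}}(c,c')=v$ if $(t,t',u'-u)\mapsto v$ is a rule of $\sigma$, $\sigma_{\mathrm{rule}}(c,c')=-v$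 if $(t',t,u-u')\mapsto v$ is a rule of $\sigma$, and leave it undefined otherwise. A two-dimensional substitution $\sigma$ is domino-complete if its set of starting patterns is, up to translation, the set of all possible dominoes on $\mathcal{A}$ (every element of $\mathcal{C}_\sigma$ is a domino, and every domino is a translate of an element of $\mathcal{C}_\sigma$). **Paths.** A $\mathcal{C}_\sigma$-path from $c_1$ to $c_n$ is a finite sequence of cells $\gamma=(c_1,\dots,c_n)$ such that $\{c_i,c_{i+1}\}$ is a translate of an element of $\mathcal{C}_\sigma$ for all $1\le i\le n-1$, and such that $c_i=c_j$ whenever $c_i$ and $c_j$ have the same vector. It is a $\mathcal{C}_\sigma$-path of a pattern $P$ if all its cells belong to $P$. A pattern $P$ is $\mathcal{C}_\sigma$-covered if for all $c,c'\in P$ there is a $\mathcal{C}_\sigma$-path of $P$ from $c$ to $c'$. The image vector of $\gamma$ is $\omega_\sigma(\gamma)=\sum_{i=1}^{n-1}\sigma_{\mathrm{rule}}(c_i,c_{i+1})$. **Consistency.** $\sigma$ is consistent on a $\mathcal{C}_\sigma$-covered pattern $P$ if for all cells $c,c'\in P$ and all $\mathcal{C}_\sigma$-paths $\gamma,\gamma'$ of $P$ from $c$ to $c'$ we have $\omega_\sigma(\gamma)=\omega_\sigma(\gamma')$. $\sigma$ is consistent if it is consistent on every $\mathcal{C}_\sigma$-covered pattern. -}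

module Defs where

open import Data.Fin using (Fin)
open import Data.Fin.Properties using (inj⇒≟)
open import Data.Integer as ℤ using (ℤ; 0ℤ; 1ℤ; -1ℤ)
open import Data.List using (List; []; _∷_; map; find; head; last)
open import Data.List.Membership.Propositional using (_∈_)
open import Data.List.Relation.Binary.BagAndSetEquality using (_∼[_]_; set)
open import Data.List.Relation.Unary.All using (All)
open import Data.List.Relation.Unary.Linked using (Linked)
open import Data.Maybe as Maybe using (Maybe; just; _<∣>_)
open import Data.Nat using (ℕ)
open import Data.Product using (_×_; _,_; ∃-syntax; Σ-syntax)
open import Data.Product.Properties using (≡-dec)
open import Data.Sum using (_⊎_)
open import Data.Vec as Vec using (Vec; []; _∷_)
import Data.Vec.Properties as Vec
open import Function.Bundles using (_↔_)
open import Function.Properties.Inverse using (↔⇒↣)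
open import Relation.Binary.Definitions using (DecidableEquality)
open import Relation.Binary.PropositionalEquality using (_≡_; _≢_)

ℤ^ : ℕ → Set
ℤ^ d = Vec ℤ d

infixl 6 _⊕_ _⊖_

_⊕_ _⊖_ : ∀ {d} → ℤ^ d → ℤ^ d → ℤ^ d
_⊕_ = Vec.zipWith ℤ._+_
_⊖_ = Vec.zipWith ℤ._-_

neg : ∀ {d} → ℤ^ d → ℤ^ d
neg = Vec.map (λ z → ℤ.- z)

𝟎 : ∀ {d} → ℤ^ d
𝟎 = Vec.replicate _ 0ℤ

record Alphabet : Set₁ where
  field
    Symbol      : Set
    size        : ℕ
    enumeration : Symbol ↔ Fin size

  _≟ₛ_ : DecidableEquality Symbol
  _≟ₛ_ = inj⇒≟ (↔⇒↣ enumeration)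

open Alphabet using (Symbol)

record Cell (d : ℕ) (𝒜 : Alphabet) : Set where
  constructor [_,_]
  field
    vec  : ℤ^ d
    type : Symbol 𝒜

open Cell public

-- A finite set of cells is a list up to `_∼[ set ]_`: order and repetitions
-- are irrelevant, and every predicate on cell sets below respects this equality.
CellSet : ℕ → Alphabet → Set
CellSet d 𝒜 = List (Cell d 𝒜)

VectorsDistinct : ∀ {d 𝒜} → CellSet d 𝒜 → Set
VectorsDistinct cs = ∀ {c c′} → c ∈ cs → c′ ∈ cs → vec c ≡ vec c′ → c ≡ c′

record Pattern (d : ℕ) (𝒜 : Alphabet) : Set where
  field
    cells    : CellSet d 𝒜
    distinct : VectorsDistinct cells

open Pattern public

translate : ∀ {d 𝒜} → ℤ^ d → CellSet d 𝒜 → CellSet d 𝒜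
translate x = map (λ c → [ x ⊕ vec c , type c ])

infix 4 _IsTranslateOf_

_IsTranslateOf_ : ∀ {d 𝒜} → CellSet d 𝒜 → CellSet d 𝒜 → Set
S IsTranslateOf T = ∃[ x ] S ∼[ set ] translate x T

LHS : ℕ → Alphabet → Set
LHS d 𝒜 = Symbol 𝒜 × Symbol 𝒜 × ℤ^ d

reversed : ∀ {d 𝒜} → LHS d 𝒜 → LHS d 𝒜
reversed (t , t′ , u) = t′ , t , neg u

offset : ∀ {d 𝒜} → LHS d 𝒜 → ℤ^ d
offset (_ , _ , u) = u

record Rule (d : ℕ) (𝒜 : Alphabet) : Set where
  constructor _↦_
  field
    lhs   : LHS d 𝒜
    image : ℤ^ d

open Rule public

record Substitution (d : ℕ) (𝒜 : Alphabet) : Set where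
  field
    base          : Symbol 𝒜 → Pattern d 𝒜
    rules         : List (Rule d 𝒜)
    nonzero       : All (λ r → offset {𝒜 = 𝒜} (lhs r) ≢ 𝟎) rules
    deterministic : ∀ {r r′} → r ∈ rules → r′ ∈ rules →
                    lhs r′ ≡ lhs r ⊎ lhs r′ ≡ reversed {𝒜 = 𝒜} (lhs r) → r′ ≡ r

open Substitution public

startingPattern : ∀ {d 𝒜} → LHS d 𝒜 → CellSet d 𝒜
startingPattern (t , t′ , u) = [ 𝟎 , t ] ∷ [ u , t′ ] ∷ []

startingPatterns : ∀ {d 𝒜} → Substitution d 𝒜 → List (CellSet d 𝒜)
startingPatterns σ = map (λ r → startingPattern (lhs r)) (rules σ)

module _ {d : ℕ} {𝒜 : Alphabet} (σ : Substitution d 𝒜) where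

  _≟ₗ_ : DecidableEquality (LHS d 𝒜)
  _≟ₗ_ = ≡-dec (Alphabet._≟ₛ_ 𝒜) (≡-dec (Alphabet._≟ₛ_ 𝒜) (Vec.≡-dec ℤ._≟_))

  -- By determinism at most one rule has a given left-hand side.
  imageOf : LHS d 𝒜 → Maybe (ℤ^ d)
  imageOf l = Maybe.map image (find (λ r → lhs r ≟ₗ l) (rules σ))

  -- By determinism and nonzero offsets at most one alternative is defined.
  σ-rule : Cell d 𝒜 → Cell d 𝒜 → Maybe (ℤ^ d)
  σ-rule [ u , t ] [ u′ , t′ ] =
    imageOf (t , t′ , u′ ⊖ u) <∣> Maybe.map neg (imageOf (t′ , t , u ⊖ u′))

  Adjacent : Cell d 𝒜 → Cell d 𝒜 → Set
  Adjacent c c′ =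
    ∃[ S ] S ∈ startingPatterns σ × (c ∷ c′ ∷ []) IsTranslateOf S

  record IsPath (c c′ : Cell d 𝒜) (γ : List (Cell d 𝒜)) : Set where
    field
      starts   : head γ ≡ just c
      ends     : last γ ≡ just c′
      linked   : Linked Adjacent γ
      distinct : VectorsDistinct γ

  IsPathOf : Pattern d 𝒜 → (c c′ : Cell d 𝒜) → List (Cell d 𝒜) → Set
  IsPathOf P c c′ γ = IsPath c c′ γ × All (_∈ cells P) γ

  Covered : Pattern d 𝒜 → Set
  Covered P = ∀ {c c′} → c ∈ cells P → c′ ∈ cells P → ∃[ γ ] IsPathOf P c c′ γ

  -- Undefined only if σ-rule is undefined on two consecutive cells, which
  -- never happens on a path.
  ω : List (Cell d 𝒜) → Maybe (ℤ^ d)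
  ω []            = just 𝟎
  ω (c ∷ [])      = just 𝟎
  ω (c ∷ c′ ∷ γ) = Maybe.zipWith _⊕_ (σ-rule c c′) (ω (c′ ∷ γ))

  -- The two image vectors are required to be defined as well as equal.
  ConsistentOn : Pattern d 𝒜 → Set
  ConsistentOn P =
    ∀ {c c′} → c ∈ cells P → c′ ∈ cells P →
    ∀ {γ γ′} → IsPathOf P c c′ γ → IsPathOf P c c′ γ′ →
    ∃[ w ] ω γ ≡ just w × ω γ′ ≡ just w

  Consistent : Set
  Consistent = ∀ P → Covered P → ConsistentOn P

unitVectors : List (ℤ^ 2)
unitVectors = (1ℤ ∷ 0ℤ ∷ []) ∷ (-1ℤ ∷ 0ℤ ∷ []) ∷
              (0ℤ ∷ 1ℤ ∷ []) ∷ (0ℤ ∷ -1ℤ ∷ []) ∷ []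

-- Such a set is automatically a pattern, as v′ ⊖ v is nonzero.
IsDomino : ∀ {𝒜} → CellSet 2 𝒜 → Set
IsDomino {𝒜} S =
  ∃[ c ] Σ[ c′ ∈ Cell 2 𝒜 ] (vec c′ ⊖ vec c) ∈ unitVectors × S ∼[ set ] (c ∷ c′ ∷ [])

DominoComplete : ∀ {𝒜} → Substitution 2 𝒜 → Set
DominoComplete σ =
  (∀ S → S ∈ startingPatterns σ → IsDomino S) ×
  (∀ D → IsDomino D → ∃[ S ] S ∈ startingPatterns σ × D IsTranslateOf S)

unitSquare : List (ℤ^ 2)
unitSquare = (0ℤ ∷ 0ℤ ∷ []) ∷ (1ℤ ∷ 0ℤ ∷ []) ∷
             (0ℤ ∷ 1ℤ ∷ []) ∷ (1ℤ ∷ 1ℤ ∷ []) ∷ []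

-- Every such pattern is covered when the substitution is domino-complete.
IsTwoByTwo : ∀ {𝒜} → Pattern 2 𝒜 → Set
IsTwoByTwo P = ∃[ x ] map vec (cells P) ∼[ set ] map (x ⊕_) unitSquare

{-# OPTIONS --safe #-}
-- Fill the holes of a pattern P with an arbitrary symbol, obtaining a colouring
-- of the whole plane.  If the images around every unit square cancel, summing the
-- horizontal steps along the x-axis and then the vertical steps above or below it
-- gives a potential φ on ℤ² in which every rule applied inside the colouring is
-- an increment; the image vector of a path of P is then the difference of φ at
-- its ends.  The cancellation around unit squares is a condition on quadruples of
-- symbols, hence decidable, and it is an instance of consistency on 2×2 patterns.
module Submission where

open import Defs
open import Data.Bool using (Bool; true; false)
open import Data.Fin.Properties using (all?)
open import Data.Integer as ℤ using (ℤ; +_; -[1+_]; 0ℤ; 1ℤ; -1ℤ)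
import Data.Integer.Properties as ℤ
open import Data.Integer.Tactic.RingSolver using (solve-∀)
open import Data.List as List using ([]; _∷_)
open import Data.List.Membership.Propositional using (_∈_; find; lose)
open import Data.List.Membership.Propositional.Properties using (∈-map⁺; ∈-map⁻)
open import Data.List.Relation.Unary.All as All using (All; []; _∷_)
open import Data.List.Relation.Unary.Any using (here; there; any?)
open import Data.List.Relation.Unary.Linked as Linked using (Linked; [-]; _∷_)
open import Data.Maybe as Maybe using (Maybe; just; _<∣>_)
open import Data.Maybe.Properties using (just-injective)
import Data.Maybe.Properties as Maybe
open import Data.Nat using (zero; suc)
open import Data.Product using (_×_; _,_; ∃-syntax; proj₁; proj₂)
open import Data.Sum using (_⊎_; inj₁; inj₂)
open import Data.Vec using ([]; _∷_)
import Data.Vec.Properties as Vec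
open import Function.Base using (id)
open import Function.Bundles using (_⇔_; mk⇔; Equivalence; Inverse)
open import Relation.Binary.Construct.Closure.ReflexiveTransitive using (Star; ε; _◅_; _◅◅_)
open import Relation.Binary.PropositionalEquality hiding ([_])
open import Relation.Nullary using (Dec; yes; no; contradiction)
open import Relation.Nullary.Decidable using (map′; _×-dec_)

open Alphabet using (Symbol)
open Equivalence using (to; from)

-- Arithmetic in ℤ².

≡-pair : ∀ {a b a′ b′ : ℤ} → a ≡ a′ → b ≡ b′ → _≡_ {A = ℤ^ 2} (a ∷ b ∷ []) (a′ ∷ b′ ∷ [])
≡-pair = cong₂ (λ a b → a ∷ b ∷ [])

⊕-comm : (u v : ℤ^ 2) → u ⊕ v ≡ v ⊕ u
⊕-comm = Vec.zipWith-comm ℤ.+-comm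

⊕-assoc : (u v w : ℤ^ 2) → (u ⊕ v) ⊕ w ≡ u ⊕ (v ⊕ w)
⊕-assoc = Vec.zipWith-assoc ℤ.+-assoc

⊕-identityˡ : (u : ℤ^ 2) → 𝟎 ⊕ u ≡ u
⊕-identityˡ = Vec.zipWith-identityˡ ℤ.+-identityˡ

⊕-identityʳ : (u : ℤ^ 2) → u ⊕ 𝟎 ≡ u
⊕-identityʳ = Vec.zipWith-identityʳ ℤ.+-identityʳ

⊖-self : (u : ℤ^ 2) → u ⊖ u ≡ 𝟎
⊖-self (a ∷ b ∷ []) = ≡-pair (lem a) (lem b)
  where
  lem : ∀ a → a ℤ.- a ≡ 0ℤ
  lem = solve-∀

neg-⊖ : (u v : ℤ^ 2) → neg (u ⊖ v) ≡ v ⊖ u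
neg-⊖ (a ∷ b ∷ []) (c ∷ d ∷ []) = ≡-pair (lem a c) (lem b d)
  where
  lem : ∀ a c → ℤ.- (a ℤ.- c) ≡ c ℤ.- a
  lem = solve-∀

⊖-cancel : (u v : ℤ^ 2) → (u ⊖ v) ⊕ v ≡ u
⊖-cancel (a ∷ b ∷ []) (c ∷ d ∷ []) = ≡-pair (lem a c) (lem b d)
  where
  lem : ∀ a c → (a ℤ.- c) ℤ.+ c ≡ a
  lem = solve-∀

⊕-⊖-cancel : (u v : ℤ^ 2) → (u ⊕ v) ⊖ u ≡ v
⊕-⊖-cancel (a ∷ b ∷ []) (c ∷ d ∷ []) = ≡-pair (lem a c) (lem b d)
  where
  lem : ∀ a c → (a ℤ.+ c) ℤ.- a ≡ c
  lem = solve-∀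

⊖-translate : (x u v : ℤ^ 2) → (x ⊕ u) ⊖ (x ⊕ v) ≡ u ⊖ v
⊖-translate (x ∷ y ∷ []) (a ∷ b ∷ []) (c ∷ d ∷ []) = ≡-pair (lem x a c) (lem y b d)
  where
  lem : ∀ x a c → (x ℤ.+ a) ℤ.- (x ℤ.+ c) ≡ a ℤ.- c
  lem = solve-∀

⊖-swap : (u u′ w w′ : ℤ^ 2) → u′ ⊖ u ≡ w′ ⊖ w → u ⊖ u′ ≡ w ⊖ w′
⊖-swap u u′ w w′ eq = trans (sym (neg-⊖ u′ u)) (trans (cong neg eq) (neg-⊖ w′ w))

⊖-telescope : (u v w : ℤ^ 2) → (v ⊖ u) ⊕ (w ⊖ v) ≡ w ⊖ u
⊖-telescope (a ∷ b ∷ []) (c ∷ d ∷ []) (e ∷ f ∷ []) = ≡-pair (lem a c e) (lem b d f)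
  where
  lem : ∀ a c e → (c ℤ.- a) ℤ.+ (e ℤ.- c) ≡ e ℤ.- a
  lem = solve-∀

⊕-cancelʳ : (w u v : ℤ^ 2) → u ⊕ w ≡ v ⊕ w → u ≡ v
⊕-cancelʳ w u v eq = trans (undo u) (trans (cong (_⊖ w) eq) (sym (undo v)))
  where
  undo : ∀ u → u ≡ (u ⊕ w) ⊖ w
  undo u = sym (trans (cong (_⊖ w) (⊕-comm u w)) (⊕-⊖-cancel w u))

⊕-inverse-unique : (u v : ℤ^ 2) → u ⊕ v ≡ 𝟎 → v ≡ neg u
⊕-inverse-unique u v eq = ⊕-cancelʳ u v (neg u)
  (trans (⊕-comm v u) (trans eq (sym (Vec.zipWith-inverseˡ ℤ.+-inverseˡ u))))

-- A vanishing sum around a square means that the two ways across it agree. The nesting and the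
-- final `𝟎` follow the unfolding of `ω`.
loop-rearrange : (p q r s : ℤ^ 2) → p ⊕ (q ⊕ (neg r ⊕ (neg s ⊕ 𝟎))) ≡ 𝟎 → p ⊕ q ≡ s ⊕ r
loop-rearrange p q r s eq =
  trans (split p q r s) (trans (cong (_⊕ (s ⊕ r)) eq) (⊕-identityˡ _))
  where
  lem : ∀ p q r s → p ℤ.+ q ≡ (p ℤ.+ (q ℤ.+ (ℤ.- r ℤ.+ (ℤ.- s ℤ.+ 0ℤ)))) ℤ.+ (s ℤ.+ r)
  lem = solve-∀
  split : ∀ p q r s → p ⊕ q ≡ (p ⊕ (q ⊕ (neg r ⊕ (neg s ⊕ 𝟎)))) ⊕ (s ⊕ r)
  split (a ∷ b ∷ []) (c ∷ d ∷ []) (e ∷ f ∷ []) (g ∷ h ∷ []) = ≡-pair (lem a c e g) (lem b d f h)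

-- Summation and induction along ℤ.

-- The signed sum from 0 to `z`: for negative `z` the values at `z`, ..., -1 are subtracted, so that
-- `integral-suc` holds on all of ℤ.
integral : (ℤ → ℤ^ 2) → ℤ → ℤ^ 2
integral a (+ zero)      = 𝟎
integral a (+ suc n)     = integral a (+ n) ⊕ a (+ n)
integral a -[1+ zero ]   = 𝟎 ⊖ a -[1+ zero ]
integral a -[1+ suc n ]  = integral a -[1+ n ] ⊖ a -[1+ suc n ]

integral-suc : ∀ a z → integral a (ℤ.suc z) ≡ integral a z ⊕ a z
integral-suc a (+ n)        = refl
integral-suc a -[1+ zero ]  = sym (⊖-cancel 𝟎 (a -[1+ zero ]))
integral-suc a -[1+ suc n ] = sym (⊖-cancel (integral a -[1+ n ]) (a -[1+ suc n ]))

ℤ-induction : (P : ℤ → Set) → P 0ℤ → (∀ z → P z → P (ℤ.suc z)) →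
              (∀ z → P (ℤ.suc z) → P z) → ∀ z → P z
ℤ-induction P p₀ up down (+ zero)      = p₀
ℤ-induction P p₀ up down (+ suc n)     = up (+ n) (ℤ-induction P p₀ up down (+ n))
ℤ-induction P p₀ up down -[1+ zero ]   = down -[1+ zero ] p₀
ℤ-induction P p₀ up down -[1+ suc n ]  = down -[1+ suc n ] (ℤ-induction P p₀ up down -[1+ n ])

-- Two columns a, b of a ladder with rungs p, each of whose squares commutes.
ladder : (a b p : ℤ → ℤ^ 2) → (∀ z → p z ⊕ b z ≡ a z ⊕ p (ℤ.suc z)) →
         ∀ z → p 0ℤ ⊕ integral b z ≡ integral a z ⊕ p z
ladder a b p square = ℤ-induction _ (⊕-comm (p 0ℤ) 𝟎) up down
  where
  open ≡-Reasoning
  bottom : ∀ z → p 0ℤ ⊕ integral b (ℤ.suc z) ≡ (p 0ℤ ⊕ integral b z) ⊕ b z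
  bottom z = trans (cong (p 0ℤ ⊕_) (integral-suc b z)) (sym (⊕-assoc _ _ _))
  top : ∀ z → integral a (ℤ.suc z) ⊕ p (ℤ.suc z) ≡ (integral a z ⊕ p z) ⊕ b z
  top z = begin
    integral a (ℤ.suc z) ⊕ p (ℤ.suc z)      ≡⟨ cong (_⊕ p (ℤ.suc z)) (integral-suc a z) ⟩
    (integral a z ⊕ a z) ⊕ p (ℤ.suc z)      ≡⟨ ⊕-assoc _ _ _ ⟩
    integral a z ⊕ (a z ⊕ p (ℤ.suc z))      ≡⟨ cong (integral a z ⊕_) (square z) ⟨
    integral a z ⊕ (p z ⊕ b z)              ≡⟨ ⊕-assoc _ _ _ ⟨
    (integral a z ⊕ p z) ⊕ b z              ∎
  up : ∀ z → p 0ℤ ⊕ integral b z ≡ integral a z ⊕ p z →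
       p 0ℤ ⊕ integral b (ℤ.suc z) ≡ integral a (ℤ.suc z) ⊕ p (ℤ.suc z)
  up z ih = trans (bottom z) (trans (cong (_⊕ b z) ih) (sym (top z)))
  down : ∀ z → p 0ℤ ⊕ integral b (ℤ.suc z) ≡ integral a (ℤ.suc z) ⊕ p (ℤ.suc z) →
         p 0ℤ ⊕ integral b z ≡ integral a z ⊕ p z
  -- Passing to `ℤ.suc z` adds the same vector `b z` on both sides, so it can be cancelled.
  down z ih = ⊕-cancelʳ (b z) _ _ (trans (sym (bottom z)) (trans ih (top z)))

zipWith-just⁻ : ∀ {A B C : Set} {f : A → B → C} (x : Maybe A) (y : Maybe B) {c} →
                Maybe.zipWith f x y ≡ just c →
                ∃[ a ] ∃[ b ] x ≡ just a × y ≡ just b × f a b ≡ c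
zipWith-just⁻ (just a) (just b) eq = a , b , refl , refl , just-injective eq

-- Unit steps of the grid.

𝟏𝟎 𝟎𝟏 𝟏𝟏 : ℤ^ 2
𝟏𝟎 = 1ℤ ∷ 0ℤ ∷ []
𝟎𝟏 = 0ℤ ∷ 1ℤ ∷ []
𝟏𝟏 = 1ℤ ∷ 1ℤ ∷ []

infix 4 _⇉_

-- Only the positive directions occur: the two orientations of an edge will carry opposite vectors,
-- so one weight per edge suffices.
data _⇉_ : ℤ^ 2 → ℤ^ 2 → Set where
  east  : ∀ {x y} → (x ∷ y ∷ []) ⇉ (ℤ.suc x ∷ y ∷ [])
  north : ∀ {x y} → (x ∷ y ∷ []) ⇉ (x ∷ ℤ.suc y ∷ [])

direction : ∀ {v v′} → v ⇉ v′ → ℤ^ 2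
direction east  = 𝟏𝟎
direction north = 𝟎𝟏

unit-sym : ∀ {u v : ℤ^ 2} → (v ⊖ u) ∈ unitVectors → (u ⊖ v) ∈ unitVectors
unit-sym {u} {v} unit = subst (_∈ unitVectors) (neg-⊖ v u) (neg-unit unit)
  where
  neg-unit : ∀ {w} → w ∈ unitVectors → neg w ∈ unitVectors
  neg-unit (here refl)                         = there (here refl)
  neg-unit (there (here refl))                 = here refl
  neg-unit (there (there (here refl)))         = there (there (there (here refl)))
  neg-unit (there (there (there (here refl)))) = there (there (here refl))

suc-difference : ∀ x → (1ℤ ℤ.+ x) ℤ.- x ≡ 1ℤ
suc-difference = solve-∀

-- The right side is the offset between cells at `𝟎` and at `direction s`, which is the form that
-- `σ-rule-translate` takes.
⇉-difference : ∀ {v v′} (s : v ⇉ v′) → v′ ⊖ v ≡ direction s ⊖ 𝟎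
⇉-difference {x ∷ y ∷ []} east  = ≡-pair (suc-difference x) (ℤ.i≡j⇒i-j≡0 {y} refl)
⇉-difference {x ∷ y ∷ []} north = ≡-pair (ℤ.i≡j⇒i-j≡0 {x} refl) (suc-difference y)

unit⇒⇉ : ∀ {v v′} → (v′ ⊖ v) ∈ unitVectors → v ⇉ v′ ⊎ v′ ⇉ v
unit⇒⇉ {x ∷ y ∷ []} {x′ ∷ y′ ∷ []} = by-cases
  where
  east-≡ : ∀ {x y x′ y′} → x′ ≡ ℤ.suc x → y′ ≡ y → (x ∷ y ∷ []) ⇉ (x′ ∷ y′ ∷ [])
  east-≡ refl refl = east
  north-≡ : ∀ {x y x′ y′} → x′ ≡ x → y′ ≡ ℤ.suc y → (x ∷ y ∷ []) ⇉ (x′ ∷ y′ ∷ [])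
  north-≡ refl refl = north
  stay : ∀ {a b} → a ≡ 0ℤ ℤ.+ b → a ≡ b
  stay {b = b} eq = trans eq (ℤ.+-identityˡ b)
  back : ∀ {a b} → a ≡ -1ℤ ℤ.+ b → b ≡ ℤ.suc a
  back {b = b} eq = sym (trans (cong ℤ.suc eq) (ℤ.suc-pred b))
  solve : ∀ {a b} → _≡_ {A = ℤ^ 2} ((x′ ℤ.- x) ∷ (y′ ℤ.- y) ∷ []) (a ∷ b ∷ []) → x′ ≡ a ℤ.+ x × y′ ≡ b ℤ.+ y
  solve eq with Vec.∷-injective (trans (sym (⊖-cancel (x′ ∷ y′ ∷ []) (x ∷ y ∷ [])))
                                        (cong (_⊕ (x ∷ y ∷ [])) eq))
  ... | p , q = p , Vec.∷-injectiveˡ q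
  by-cases : (x′ ∷ y′ ∷ []) ⊖ (x ∷ y ∷ []) ∈ unitVectors →
             (x ∷ y ∷ []) ⇉ (x′ ∷ y′ ∷ []) ⊎ (x′ ∷ y′ ∷ []) ⇉ (x ∷ y ∷ [])
  by-cases (here eq)                         = let p , q = solve eq in inj₁ (east-≡ p (stay q))
  by-cases (there (here eq))                 = let p , q = solve eq in inj₂ (east-≡ (back p) (sym (stay q)))
  by-cases (there (there (here eq)))         = let p , q = solve eq in inj₁ (north-≡ (stay p) q)
  by-cases (there (there (there (here eq)))) = let p , q = solve eq in inj₂ (north-≡ (sym (stay p)) (back q))

-- Finite quantification and colourings of the plane.

module _ {𝒜 : Alphabet} where

  all-symbols? : {P : Symbol 𝒜 → Set} → (∀ s → Dec (P s)) → Dec (∀ s → P s)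
  all-symbols? {P} P? =
    map′ (λ g s → subst P (Inverse.strictlyInverseʳ e s) (g (Inverse.to e s)))
         (λ g i → g (Inverse.from e i))
         (all? (λ i → P? (Inverse.from e i)))
    where e = Alphabet.enumeration 𝒜

  UnitStep : Cell 2 𝒜 → Cell 2 𝒜 → Set
  UnitStep c c′ = (vec c′ ⊖ vec c) ∈ unitVectors

  module Colouring (P : Pattern 2 𝒜) (default : Symbol 𝒜) where

    colour : ℤ^ 2 → Symbol 𝒜
    colour v with any? (λ c → Vec.≡-dec ℤ._≟_ (vec c) v) (cells P)
    ... | yes p = type (proj₁ (find p))
    ... | no _  = default

    -- The search may stop at another occurrence over the same vector, but `distinct` identifies it
    -- with `c`.
    colour-cell : ∀ {c} → c ∈ cells P → colour (vec c) ≡ type c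
    colour-cell {c} c∈P with any? (λ c′ → Vec.≡-dec ℤ._≟_ (vec c′) (vec c)) (cells P)
    ... | yes p = let _ , c′∈P , eq = find p in cong type (distinct P c′∈P c∈P eq)
    ... | no ¬p = contradiction (lose c∈P refl) ¬p

  -- The finite flatness condition.

  module _ (σ : Substitution 2 𝒜) where

    -- `σ-rule` sees the positions only through the two offsets, and the second offset is the
    -- negation of the first.
    σ-rule-translate : ∀ {u u′ w w′ t t′} → u′ ⊖ u ≡ w′ ⊖ w →
                       σ-rule σ [ u , t ] [ u′ , t′ ] ≡ σ-rule σ [ w , t ] [ w′ , t′ ]
    σ-rule-translate {u} {u′} {w} {w′} {t} {t′} eq =
      cong₂ (λ d e → imageOf σ (t , t′ , d) <∣> Maybe.map neg (imageOf σ (t′ , t , e)))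
            eq (⊖-swap u u′ w w′ eq)

    -- As ω takes values in Maybe, this asserts that the rule is defined in both
    -- directions, and that the two images are opposite.
    Backtrack : ℤ^ 2 → Symbol 𝒜 → Symbol 𝒜 → Set
    Backtrack e t t′ = ω σ ([ 𝟎 , t ] ∷ [ e , t′ ] ∷ [ 𝟎 , t ] ∷ []) ≡ just 𝟎

    -- Anticlockwise from the lower left corner. The symbols are named in the order of `unitSquare`,
    -- so the walk meets `d` before `c`.
    Loop : (a b c d : Symbol 𝒜) → Set
    Loop a b c d =
      ω σ ([ 𝟎 , a ] ∷ [ 𝟏𝟎 , b ] ∷ [ 𝟏𝟏 , d ] ∷ [ 𝟎𝟏 , c ] ∷ [ 𝟎 , a ] ∷ []) ≡ just 𝟎

    -- Zero curvature of a discrete connection, as finitely many equations: steps back and forth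
    -- cancel, and the holonomy around every coloured unit square vanishes.
    Flat : Set
    Flat = (∀ t t′ → Backtrack 𝟏𝟎 t t′) × (∀ t t′ → Backtrack 𝟎𝟏 t t′) ×
           (∀ a b c d → Loop a b c d)

    Flat? : Dec Flat
    Flat? = (all-symbols? λ t → all-symbols? λ t′ → _ ≟ just 𝟎) ×-dec
            (all-symbols? λ t → all-symbols? λ t′ → _ ≟ just 𝟎) ×-dec
            (all-symbols? λ a → all-symbols? λ b → all-symbols? λ c → all-symbols? λ d →
              _ ≟ just 𝟎)
      where _≟_ = Maybe.≡-dec (Vec.≡-dec ℤ._≟_)

    Opposite : ℤ^ 2 → Symbol 𝒜 → Symbol 𝒜 → Set
    Opposite e t t′ =
      ∃[ w ] σ-rule σ [ 𝟎 , t ] [ e , t′ ] ≡ just w × σ-rule σ [ e , t′ ] [ 𝟎 , t ] ≡ just (neg w)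

    backtrack⇒opposite : ∀ e t t′ → Backtrack e t t′ → Opposite e t t′
    backtrack⇒opposite e t t′ eq =
      let w , _ , there≡w , rest , w⊕w′≡𝟎 = zipWith-just⁻ _ _ eq
          w′ , _ , back≡w′ , 𝟎≡ , w′⊕≡    = zipWith-just⁻ _ _ rest
          -- The last single cell contributes a summand `𝟎` to `ω`, which is removed here.
          w′≡ = trans (sym (⊕-identityʳ w′)) (trans (cong (w′ ⊕_) (just-injective 𝟎≡)) w′⊕≡)
      in w , there≡w , trans back≡w′ (cong just (trans w′≡ (⊕-inverse-unique w _ w⊕w′≡𝟎)))

    -- The potential of a colouring.

    module FromFlat (flat : Flat) where

      hor-opposite : ∀ t t′ → Opposite 𝟏𝟎 t t′
      hor-opposite t t′ = backtrack⇒opposite 𝟏𝟎 t t′ (proj₁ flat t t′)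

      ver-opposite : ∀ t t′ → Opposite 𝟎𝟏 t t′
      ver-opposite t t′ = backtrack⇒opposite 𝟎𝟏 t t′ (proj₁ (proj₂ flat) t t′)

      hor ver : Symbol 𝒜 → Symbol 𝒜 → ℤ^ 2
      hor t t′ = proj₁ (hor-opposite t t′)
      ver t t′ = proj₁ (ver-opposite t t′)

      weight : ∀ {v v′} → v ⇉ v′ → Symbol 𝒜 → Symbol 𝒜 → ℤ^ 2
      weight east  = hor
      weight north = ver

      σ-rule-forward : ∀ {v v′} (s : v ⇉ v′) t t′ →
                       σ-rule σ [ v , t ] [ v′ , t′ ] ≡ just (weight s t t′)
      σ-rule-forward s t t′ = trans (σ-rule-translate (⇉-difference s)) (lem s)
        where
        lem : ∀ {v v′} (s : v ⇉ v′) → σ-rule σ [ 𝟎 , t ] [ direction s , t′ ] ≡ just (weight s t t′)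
        lem east  = proj₁ (proj₂ (hor-opposite t t′))
        lem north = proj₁ (proj₂ (ver-opposite t t′))

      σ-rule-backward : ∀ {v v′} (s : v ⇉ v′) t t′ →
                        σ-rule σ [ v′ , t′ ] [ v , t ] ≡ just (neg (weight s t t′))
      σ-rule-backward {v} {v′} s t t′ =
        trans (σ-rule-translate (⊖-swap v v′ 𝟎 (direction s) (⇉-difference s))) (lem s)
        where
        lem : ∀ {v v′} (s : v ⇉ v′) →
              σ-rule σ [ direction s , t′ ] [ 𝟎 , t ] ≡ just (neg (weight s t t′))
        lem east  = proj₂ (proj₂ (hor-opposite t t′))
        lem north = proj₂ (proj₂ (ver-opposite t t′))

      -- The loop runs through the top and left sides backwards, so their weights enter negated and
      -- move to the other side of the equation.
      square : ∀ a b c d → hor a b ⊕ ver b d ≡ ver a c ⊕ hor c d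
      square a b c d = loop-rearrange (hor a b) (ver b d) (hor c d) (ver a c)
        (just-injective (trans (sym images) (proj₂ (proj₂ flat) a b c d)))
        where
        images : ω σ ([ 𝟎 , a ] ∷ [ 𝟏𝟎 , b ] ∷ [ 𝟏𝟏 , d ] ∷ [ 𝟎𝟏 , c ] ∷ [ 𝟎 , a ] ∷ [])
               ≡ just (hor a b ⊕ (ver b d ⊕ (neg (hor c d) ⊕ (neg (ver a c) ⊕ 𝟎))))
        images = σ-rule-forward {𝟎} east a b ⟨⊕⟩ (σ-rule-forward {𝟏𝟎} north b d ⟨⊕⟩
                 (σ-rule-backward {𝟎𝟏} east c d ⟨⊕⟩ (σ-rule-backward {𝟎} north a c ⟨⊕⟩ refl)))
          where
          _⟨⊕⟩_ : ∀ {p q r s : Maybe (ℤ^ 2)} → p ≡ q → r ≡ s →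
                  Maybe.zipWith _⊕_ p r ≡ Maybe.zipWith _⊕_ q s
          _⟨⊕⟩_ = cong₂ (Maybe.zipWith _⊕_)

      module _ (f : ℤ^ 2 → Symbol 𝒜) where

        hor-at ver-at : ℤ → ℤ → ℤ^ 2
        hor-at x y = hor (f (x ∷ y ∷ [])) (f (ℤ.suc x ∷ y ∷ []))
        ver-at x y = ver (f (x ∷ y ∷ [])) (f (x ∷ ℤ.suc y ∷ []))

        φ : ℤ^ 2 → ℤ^ 2
        φ (x ∷ y ∷ []) = integral (λ i → hor-at i 0ℤ) x ⊕ integral (ver-at x) y

        -- A step north extends the vertical sum by one term. A step east changes the whole column,
        -- and the commuting squares between the two columns account for the difference.
        φ-increment : ∀ {v v′} (s : v ⇉ v′) → φ v′ ⊖ φ v ≡ weight s (f v) (f v′)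
        φ-increment {v} {v′} s = trans (cong (_⊖ φ v) (lem s)) (⊕-⊖-cancel (φ v) _)
          where
          open ≡-Reasoning
          lem : ∀ {v v′} (s : v ⇉ v′) → φ v′ ≡ φ v ⊕ weight s (f v) (f v′)
          lem (north {x} {y}) =
            trans (cong (_ ⊕_) (integral-suc (ver-at x) y)) (sym (⊕-assoc _ _ _))
          lem (east {x} {y}) = begin
            H (ℤ.suc x) ⊕ V (ℤ.suc x)            ≡⟨ cong (_⊕ V (ℤ.suc x)) (integral-suc (λ i → hor-at i 0ℤ) x) ⟩
            (H x ⊕ hor-at x 0ℤ) ⊕ V (ℤ.suc x)    ≡⟨ ⊕-assoc (H x) _ _ ⟩
            -- The ladder between the columns `x` and `ℤ.suc x` carries its rung on the axis to
            -- height `y`.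
            H x ⊕ (hor-at x 0ℤ ⊕ V (ℤ.suc x))    ≡⟨ cong (H x ⊕_) (ladder (ver-at x) (ver-at (ℤ.suc x)) (hor-at x) squares y) ⟩
            H x ⊕ (V x ⊕ hor-at x y)             ≡⟨ ⊕-assoc (H x) _ _ ⟨
            (H x ⊕ V x) ⊕ hor-at x y             ∎
            where
            squares : ∀ z → hor-at x z ⊕ ver-at (ℤ.suc x) z ≡ ver-at x z ⊕ hor-at x (ℤ.suc z)
            squares z = square (f (x ∷ z ∷ [])) (f (ℤ.suc x ∷ z ∷ []))
                               (f (x ∷ ℤ.suc z ∷ [])) (f (ℤ.suc x ∷ ℤ.suc z ∷ []))
            H V : ℤ → ℤ^ 2
            H = integral (λ i → hor-at i 0ℤ)
            V i = integral (ver-at i) y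

        σ-rule-increment : ∀ {v v′} → (v′ ⊖ v) ∈ unitVectors →
                           σ-rule σ [ v , f v ] [ v′ , f v′ ] ≡ just (φ v′ ⊖ φ v)
        σ-rule-increment {v} {v′} unit with unit⇒⇉ unit
        ... | inj₁ s = trans (σ-rule-forward s _ _) (cong just (sym (φ-increment s)))
        ... | inj₂ s = trans (σ-rule-backward s _ _)
                (cong just (trans (cong neg (sym (φ-increment s))) (neg-⊖ (φ v) (φ v′))))

    -- Image vectors of paths as potential differences.

    module _ (complete : DominoComplete σ) where

      unit⇒adjacent : ∀ {c c′} → UnitStep c c′ → Adjacent σ c c′
      unit⇒adjacent unit = proj₂ complete _ (_ , _ , unit , mk⇔ id id)

      -- Equality as sets fixes the two cells only up to order, and the unit vectors are closed
      -- under negation.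
      adjacent⇒unit : ∀ {c c′} → Adjacent σ c c′ → UnitStep c c′
      adjacent⇒unit {c} {c′} (S , S∈ , x , cc′∼) with proj₁ complete S S∈
      ... | d , d′ , unit , S∼ = pick (subst (_∈ unitVectors) (sym (⊖-translate x (vec d′) (vec d))) unit)
                                      (member (here refl))
                                      (member (there (here refl)))
                                      (hit (here refl)) (hit (there (here refl)))
        where
        shift : Cell 2 𝒜 → Cell 2 𝒜
        shift e = [ x ⊕ vec e , type e ]
        member : ∀ {e} → e ∈ c ∷ c′ ∷ [] → e ≡ shift d ⊎ e ≡ shift d′
        member e∈ with ∈-map⁻ shift (to cc′∼ e∈)
        ... | _ , e₀∈ , refl with to S∼ e₀∈
        ...   | here refl         = inj₁ refl
        ...   | there (here refl) = inj₂ refl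
        hit : ∀ {e} → e ∈ d ∷ d′ ∷ [] → shift e ≡ c ⊎ shift e ≡ c′
        hit e∈ with from cc′∼ (∈-map⁺ shift (from S∼ e∈))
        ... | here eq         = inj₁ eq
        ... | there (here eq) = inj₂ eq
        pick : ∀ {c c′ e e′ : Cell 2 𝒜} → UnitStep e e′ →
               c ≡ e ⊎ c ≡ e′ → c′ ≡ e ⊎ c′ ≡ e′ → e ≡ c ⊎ e ≡ c′ → e′ ≡ c ⊎ e′ ≡ c′ →
               UnitStep c c′
        pick unit (inj₁ refl) (inj₂ refl) _ _ = unit
        pick unit (inj₂ refl) (inj₁ refl) _ _ = unit-sym unit
        -- If `c` and `c′` coincide, the last two arguments make `e` and `e′` coincide with them,
        -- and `unit` already has the required type.
        pick unit (inj₁ refl) (inj₁ refl) _ (inj₁ refl) = unit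
        pick unit (inj₁ refl) (inj₁ refl) _ (inj₂ refl) = unit
        pick unit (inj₂ refl) (inj₂ refl) (inj₁ refl) _ = unit
        pick unit (inj₂ refl) (inj₂ refl) (inj₂ refl) _ = unit

      ω-increment : (f : ℤ^ 2 → Symbol 𝒜) (flat : Flat) → ∀ {c c′ γ} → IsPath σ c c′ γ →
                    All (λ e → f (vec e) ≡ type e) γ →
                    ω σ γ ≡ just (FromFlat.φ flat f (vec c′) ⊖ FromFlat.φ flat f (vec c))
      ω-increment f flat record { starts = starts ; ends = ends ; linked = linked } =
        go starts ends linked
        where
        open FromFlat flat
        go : ∀ {c c′ γ} → List.head γ ≡ just c → List.last γ ≡ just c′ → Linked (Adjacent σ) γ →
             All (λ e → f (vec e) ≡ type e) γ → ω σ γ ≡ just (φ f (vec c′) ⊖ φ f (vec c))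
        go {c} refl refl [-] _ = cong just (sym (⊖-self (φ f (vec c))))
        -- Matching on both `refl` replaces the types of `c` and `e` by their colours under `f`, so
        -- that `σ-rule-increment` can rewrite; the differences then telescope.
        go {c} {c′} refl ends (_∷_ {y = e} adj linked) (refl ∷ eqs@(refl ∷ _))
          rewrite σ-rule-increment f {vec c} {vec e} (adjacent⇒unit adj)
                | go refl ends linked eqs
          = cong just (⊖-telescope (φ f (vec c)) (φ f (vec e)) (φ f (vec c′)))

      flat⇒consistent : Flat → Consistent σ
      flat⇒consistent flat P _ {c} c∈P c′∈P (path , inP) (path′ , inP′) =
        _ , ω-increment colour flat path (All.map colour-cell inP)
          , ω-increment colour flat path′ (All.map colour-cell inP′)
        -- An alphabet may be empty; the given cell supplies a symbol for the holes.
        where open Colouring P (type c)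

      -- Walks, paths and the coveredness of 2×2 patterns.

      unit-path : (P : Pattern 2 𝒜) → ∀ {c c′ γ} → List.head γ ≡ just c → List.last γ ≡ just c′ →
                  Linked UnitStep γ → All (_∈ cells P) γ →
                  IsPathOf σ P c c′ γ
      unit-path P starts ends linked inP = record
        { starts   = starts
        ; ends     = ends
        ; linked   = Linked.map unit⇒adjacent linked
        ; distinct = λ e∈ e′∈ → distinct P (All.lookup inP e∈) (All.lookup inP e′∈)
        } , inP

      -- Only the target is asked to lie in `P`; membership of the first cell of a walk is given
      -- separately, and each later source is an earlier target.
      Step : Pattern 2 𝒜 → Cell 2 𝒜 → Cell 2 𝒜 → Set
      Step P e e′ = UnitStep e e′ × e′ ∈ cells P

      walk⇒path : (P : Pattern 2 𝒜) → ∀ {c c′} → c ∈ cells P → Star (Step P) c c′ →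
                  ∃[ γ ] IsPathOf σ P c c′ γ
      walk⇒path P c∈P walk =
        let γ , ends , linked , inP = go c∈P walk in _ ∷ γ , unit-path P refl ends linked inP
        where
        -- Returning only the cells after the first keeps the head of the path explicit.
        go : ∀ {c c′} → c ∈ cells P → Star (Step P) c c′ →
             ∃[ γ ] List.last (c ∷ γ) ≡ just c′ ×
                    Linked UnitStep (c ∷ γ) ×
                    All (_∈ cells P) (c ∷ γ)
        go c∈P ε = [] , refl , [-] , c∈P ∷ []
        go c∈P ((unit , e∈P) ◅ walk) =
          let γ , ends , linked , inP = go e∈P walk
          in _ ∷ γ , ends , unit ∷ linked , c∈P ∷ inP

      -- With corners indexed by two bits, a walk adjusts the first bit along a row and then the
      -- second along a column.
      twoByTwo-covered : (P : Pattern 2 𝒜) → IsTwoByTwo P → Covered σ P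
      twoByTwo-covered P (x , vecs∼) {c} {c′} c∈P c′∈P =
        let i , j , c≡ = locate c∈P ; i′ , j′ , c′≡ = locate c′∈P
        in subst₂ (λ e e′ → ∃[ γ ] IsPathOf σ P e e′ γ) (sym c≡) (sym c′≡) (walk i j i′ j′)
        where
        corner : Bool → Bool → ℤ^ 2
        corner i j = bit i ∷ bit j ∷ []
          where
          bit : Bool → ℤ
          bit false = 0ℤ
          bit true  = 1ℤ
        corner∈ : ∀ i j → corner i j ∈ unitSquare
        corner∈ false false = here refl
        corner∈ true  false = there (here refl)
        corner∈ false true  = there (there (here refl))
        corner∈ true  true  = there (there (there (here refl)))
        ∈corners : ∀ {v} → v ∈ unitSquare → ∃[ i ] ∃[ j ] v ≡ corner i j
        ∈corners (here refl)                         = false , false , refl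
        ∈corners (there (here refl))                 = true  , false , refl
        ∈corners (there (there (here refl)))         = false , true  , refl
        ∈corners (there (there (there (here refl)))) = true  , true  , refl
        -- One direction of `vecs∼` provides a cell over each corner; the other, with `distinct`,
        -- shows in `locate` that there are no further cells.
        at : ∀ i j → ∃[ e ] e ∈ cells P × x ⊕ corner i j ≡ vec e
        at i j = ∈-map⁻ vec (from vecs∼ (∈-map⁺ (x ⊕_) (corner∈ i j)))
        cell : Bool → Bool → Cell 2 𝒜
        cell i j = proj₁ (at i j)
        cell∈P : ∀ i j → cell i j ∈ cells P
        cell∈P i j = proj₁ (proj₂ (at i j))
        locate : ∀ {e} → e ∈ cells P → ∃[ i ] ∃[ j ] e ≡ cell i j
        locate e∈P with ∈-map⁻ (x ⊕_) (to vecs∼ (∈-map⁺ vec e∈P))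
        ... | v , v∈ , e≡ with ∈corners v∈
        ...   | i , j , refl = i , j , distinct P e∈P (cell∈P i j) (trans e≡ (proj₂ (proj₂ (at i j))))
        unit : ∀ i j i′ j′ → (corner i′ j′ ⊖ corner i j) ∈ unitVectors →
               UnitStep (cell i j) (cell i′ j′)
        unit i j i′ j′ = subst (_∈ unitVectors)
          (trans (sym (⊖-translate x (corner i′ j′) (corner i j)))
                 (cong₂ _⊖_ (proj₂ (proj₂ (at i′ j′))) (proj₂ (proj₂ (at i j)))))
        Walk : Cell 2 𝒜 → Cell 2 𝒜 → Set
        Walk = Star (Step P)
        step : ∀ i j i′ j′ → (corner i′ j′ ⊖ corner i j) ∈ unitVectors → Walk (cell i j) (cell i′ j′)
        step i j i′ j′ corners = (unit i j i′ j′ corners , cell∈P i′ j′) ◅ ε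
        horizontally : ∀ i i′ j → Walk (cell i j) (cell i′ j)
        horizontally false false j     = ε
        horizontally true  true  j     = ε
        horizontally false true  false = step false false true false (here refl)
        horizontally false true  true  = step false true true true (here refl)
        horizontally true  false false = step true false false false (there (here refl))
        horizontally true  false true  = step true true false true (there (here refl))
        vertically : ∀ i j j′ → Walk (cell i j) (cell i j′)
        vertically i     false false = ε
        vertically i     true  true  = ε
        vertically false false true  = step false false false true (there (there (here refl)))
        vertically true  false true  = step true false true true (there (there (here refl)))
        vertically false true  false = step false true false false (there (there (there (here refl))))
        vertically true  true  false = step true true true false (there (there (there (here refl))))
        walk : ∀ i j i′ j′ → ∃[ γ ] IsPathOf σ P (cell i j) (cell i′ j′) γ
        walk i j i′ j′ =
          walk⇒path P (cell∈P i j) (horizontally i i′ j ◅◅ vertically i′ j j′)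

      -- Flatness from consistency on 2×2 patterns.

      module _ (consistent : ∀ P → IsTwoByTwo P → ConsistentOn σ P) where

        squarePattern : (a b c d : Symbol 𝒜) → Pattern 2 𝒜
        squarePattern a b c d = record
          { cells    = List.map (λ v → [ v , symbol v ]) unitSquare
          ; distinct = λ c∈ c′∈ eq → lem (∈-map⁻ _ c∈) (∈-map⁻ _ c′∈) eq
          }
          where
          symbol : ℤ^ 2 → Symbol 𝒜
          symbol (+ 0 ∷ + 0 ∷ []) = a
          symbol (+ 1 ∷ + 0 ∷ []) = b
          symbol (+ 0 ∷ + 1 ∷ []) = c
          -- Within `unitSquare` only `𝟏𝟏` reaches this clause.
          symbol _                = d
          lem : ∀ {e e′} → ∃[ v ] v ∈ unitSquare × e ≡ [ v , symbol v ] →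
                ∃[ v ] v ∈ unitSquare × e′ ≡ [ v , symbol v ] → vec e ≡ vec e′ → e ≡ e′
          lem (_ , _ , refl) (_ , _ , refl) refl = refl

        -- The path is compared with the one-cell path at its starting point, whose image vector is
        -- `𝟎`.
        closed-path : ∀ a b c d {γ} → let P = squarePattern a b c d in
                      List.head γ ≡ just [ 𝟎 , a ] → List.last γ ≡ just [ 𝟎 , a ] →
                      Linked UnitStep γ → All (_∈ cells P) γ →
                      ω σ γ ≡ just 𝟎
        closed-path a b c d starts ends linked inP =
          let P = squarePattern a b c d
              _ , γ≡ , 𝟎≡ = consistent P (𝟎 , mk⇔ id id) (here refl) (here refl)
                              (unit-path P starts ends linked inP)
                              (unit-path P refl refl [-] (here refl ∷ []))
          in trans γ≡ (sym 𝟎≡)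

        flat : Flat
        -- The edge walked back and forth is the bottom side, in the next component the left side;
        -- `t` fills the other two corners.
        flat = (λ t t′ → closed-path t t′ t t refl refl
                  (here refl ∷ there (here refl) ∷ [-])
                  (here refl ∷ there (here refl) ∷ here refl ∷ []))
             , (λ t t′ → closed-path t t t′ t refl refl
                  (there (there (here refl)) ∷ there (there (there (here refl))) ∷ [-])
                  (here refl ∷ there (there (here refl)) ∷ here refl ∷ []))
             , (λ a b c d → closed-path a b c d refl refl
                  (here refl ∷ there (there (here refl)) ∷ there (here refl)
                    ∷ there (there (there (here refl))) ∷ [-])
                  (here refl ∷ there (here refl) ∷ there (there (there (here refl)))
                    ∷ there (there (here refl)) ∷ here refl ∷ []))

-- Decidability and the equivalence.

theorem4p1 : (𝒜 : Alphabet) (σ : Substitution 2 𝒜) → DominoComplete σ →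
    Dec (Consistent σ) ×
    (Consistent σ ⇔ (∀ (P : Pattern 2 𝒜) → IsTwoByTwo P → ConsistentOn σ P))
theorem4p1 𝒜 σ complete =
    -- The decidable `Flat` links both claims: it implies consistency and follows from consistency
    -- on 2×2 patterns.
    map′ (flat⇒consistent σ complete) (λ con → flat σ complete (restrict con)) (Flat? σ)
  , mk⇔ restrict (λ con → flat⇒consistent σ complete (flat σ complete con))
  where
  restrict : Consistent σ → ∀ P → IsTwoByTwo P → ConsistentOn σ P
  restrict con P square = con P (twoByTwo-covered σ complete P square)
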